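{- The loop existence and elimination property LEE does not hold in general for chart interpretations of star expressions. Specifically, for pairwise distinct actions: (1) the chart interpretation $\mathcal{C}(e)$ of $e=(a^*\cdot b^*)^*$ does not satisfy LEE; (2) the chart interpretation $\mathcal{C}(f)$ of $f=f_0^*\cdot 0$, where $f_0=a_1\cdot(1+b_1\cdot 0)+\bigl(a_2\cdot(1+b_2\cdot 0)+a_3\cdot(1+b_3\cdot 0)\bigr)$, does not satisfy LEE.
   Context: Let $A$ be a set of actions. Star expressions: $\mathit{StExp}(A)$ is given by $e ::= 0 \mid 1 \mid a \mid e_1+e_2 \mid e_1\cdot e_2 \mid e^*$ with $a\in A$ (pure syntax). Transitions $e\xrightarrow{a}e'$ and termination $e\downarrow$ are defined inductively by: $1\downarrow$; $(e_1+e_2)\downarrow$ if $e_i\downarrow$ for some $i\in\{1,2\}$; $(e_1\cdot e_2)\downarrow$ if $e_1\downarrow$ and $e_2\downarrow$; $(e^*)\downarrow$; $a\xrightarrow{a}1$; $e_1+e_2\xrightarrow{a}e_i'$ if $e_i\xrightarrow{a}e_i'$; $e_1\cdot e_2\xrightarrow{a}e_1'\cdot e_2$ if $e_1\xrightarrow{a}e_1'$; $e_1\cdot e_2\xrightarrow{a}e_2'$ if $e_1\downarrow$ and $e_2\xrightarrow{a}e_2'$; $e^*\xrightarrow{a}e'\cdot e^*$ if $e\xrightarrow{a}e'$. The chart interpretation $\mathcal{C}(e)$ consists of all star expressions reachable from $e$, with these transitions and terminating vertices, and start vertex $e$ (it is finite). A chart is a rooted labeled transition system with a finite set of vertices, a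 start vertex, and a set of terminating vertices. A chart with start vertex $v_s$ is a loop chart if: (L1) there is an infinite path from $v_s$; (L2) every infinite path from $v_s$ returns to $v_s$ after a positive number of transitions; (L3) no vertex other than $v_s$ is terminating. A loop subchart of a chart $\mathcal{C}$ is a loop chart that is the subchart of $\mathcal{C}$ rooted at some vertex $v$ generated, for a nonempty set $U$ of transitions of $\mathcal{C}$ from $v$, by all paths that start with a transition in $U$ and continue onward until $v$ is reached again (termination inherited from $\mathcal{C}$); the transitions in $U$ are its loop-entry transitions. Eliminating it from $\mathcal{C}$ means removing its loop-entry transitions from $\mathcal{C}$ and then removing all vertices and transitions that have become unreachable from the start vertex. A chart satisfies LEE if some run of repeated elimination of loop subcharts, started on it, leads to a chart without an infinite path. -}

module Defs where

open import Data.List.Base using (List; []; _∷_; [_]; _++_; map)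
open import Data.List.Membership.Propositional using (_∈_)
open import Data.List.Membership.Propositional.Properties
  using (∈-++⁺ˡ; ∈-++⁺ʳ; ∈-++⁻; ∈-map⁺; ∈-map⁻)
open import Data.List.Relation.Unary.Any using (here; there)
open import Data.Nat.Base using (ℕ; zero; suc; _<_)
open import Data.Product.Base using (Σ; ∃; ∃-syntax; ∃₂; _×_; _,_; proj₁; proj₂)
open import Data.Sum.Base using (inj₁; inj₂)
open import Level using (0ℓ)
open import Relation.Binary.Construct.Closure.ReflexiveTransitive
  using (Star; ε; _◅_)
open import Relation.Binary.PropositionalEquality using (_≡_; _≢_; refl)
open import Relation.Nullary using (¬_)
open import Relation.Unary using (Pred; _⊆_)

LabelledRel : Set → Set → Set₁
LabelledRel A V = V → A → V → Set

-- A subset of V is finite when some list covers it (the list may contain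
-- further elements of V, so that subsets of finite sets are finite).
Finite : {V : Set} → Pred V 0ℓ → Set
Finite {V} P = Σ (List V) λ xs → P ⊆ (_∈ xs)

-- The vertices of a chart form a subset of an ambient type V, so that
-- subcharts of a chart live over the same V.
record Chart (A V : Set) : Set₁ where
  field
    Vertex : Pred V 0ℓ
    finite : Finite Vertex
    start  : V
    Step   : LabelledRel A V
    Term   : Pred V 0ℓ

    start-vertex  : Vertex start
    source-vertex : ∀ {x a y} → Step x a y → Vertex x
    target-vertex : ∀ {x a y} → Step x a y → Vertex y
    term-vertex   : ∀ {x} → Term x → Vertex x

Reachable : {A V : Set} → LabelledRel A V → V → Pred V 0ℓ
Reachable R = Star (λ x y → ∃[ a ] R x a y)

module _ {A V : Set} where

  reachableChart : (R : LabelledRel A V) (T : Pred V 0ℓ) (s : V) →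
                   Finite (Reachable R s) → Chart A V
  reachableChart R T s fin = record
    { Vertex        = Reachable R s
    ; finite        = fin
    ; start         = s
    ; Step          = λ x a y → Reachable R s x × R x a y
    ; Term          = λ x → Reachable R s x × T x
    ; start-vertex  = ε
    ; source-vertex = proj₁
    ; target-vertex = λ (r , t) → snoc r (_ , t)
    ; term-vertex   = proj₁
    }
    where
    snoc : ∀ {x y z} → Reachable R x y → ∃[ a ] R y a z → Reachable R x z
    snoc ε       t = t ◅ ε
    snoc (u ◅ r) t = u ◅ snoc r t

  -- Reachability along a subrelation of the transitions of C stays inside C.
  restrict-finite : (C : Chart A V) (R : LabelledRel A V) {s : V} →
                    Chart.Vertex C s →
                    (∀ {x a y} → R x a y → Chart.Step C x a y) →
                    Finite (Reachable R s)
  restrict-finite C R vs sub = proj₁ finite , λ r → proj₂ finite (inside vs r)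
    where
    open Chart C
    inside : ∀ {x y} → Vertex x → Reachable R x y → Vertex y
    inside vx ε             = vx
    inside vx ((_ , t) ◅ r) = inside (target-vertex (sub t)) r

  record InfinitePath (C : Chart A V) (x : V) : Set where
    open Chart C
    field
      vertex : ℕ → V
      label  : ℕ → A
      begins : vertex 0 ≡ x
      steps  : ∀ n → Step (vertex n) (label n) (vertex (suc n))

  record IsLoopChart (C : Chart A V) : Set where
    open Chart C
    open InfinitePath
    field
      L1 : InfinitePath C start
      L2 : (π : InfinitePath C start) → ∃[ n ] (0 < n × vertex π n ≡ start)
      L3 : ∀ {x} → Vertex x → x ≢ start → ¬ Term x

  module _ (C : Chart A V) where
    open Chart C

    -- A nonempty set U of transitions from a vertex v; "U a w" says that
    -- the transition from v to w labelled a belongs to U.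
    record EntrySet : Set₁ where
      field
        v        : V
        U        : A → V → Set
        v-vertex : Vertex v
        U-steps  : ∀ {a w} → U a w → Step v a w
        nonempty : ∃₂ U

    module _ (E : EntrySet) where
      open EntrySet E

      -- The transitions on paths that start with a transition in U and
      -- continue onward until v is reached again.
      data Generated : LabelledRel A V where
        entry  : ∀ {a w} → U a w → Generated v a w
        onward : ∀ {x a y b z} → Generated x a y → y ≢ v → Step y b z →
                 Generated y b z

      generated-step : ∀ {x a y} → Generated x a y → Step x a y
      generated-step (entry u)      = U-steps u
      generated-step (onward _ _ t) = t

      generatedSubchart : Chart A V
      generatedSubchart = reachableChart Generated Term v
        (restrict-finite C Generated v-vertex generated-step)

      Remaining : LabelledRel A V
      Remaining x a y = Step x a y × ¬ (x ≡ v × U a y)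

      eliminate : Chart A V
      eliminate = reachableChart Remaining Term start
        (restrict-finite C Remaining start-vertex proj₁)

  data _⟹_ (C : Chart A V) : Chart A V → Set₁ where
    elim : (E : EntrySet C) → IsLoopChart (generatedSubchart C E) →
           C ⟹ eliminate C E

  LEE : Chart A V → Set₁
  LEE C = ∃[ C′ ] (Star _⟹_ C C′ × ¬ (∃[ x ] InfinitePath C′ x))

infixl 6 _+_
infixl 7 _·_
infix  9 _*

data StExp (A : Set) : Set where
  𝟘 𝟙     : StExp A
  act     : A → StExp A
  _+_ _·_ : StExp A → StExp A → StExp A
  _*      : StExp A → StExp A

module _ {A : Set} where

  data _↓ : StExp A → Set where
    𝟙↓  : 𝟙 ↓
    +↓₁ : ∀ {e₁ e₂} → e₁ ↓ → (e₁ + e₂) ↓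
    +↓₂ : ∀ {e₁ e₂} → e₂ ↓ → (e₁ + e₂) ↓
    ·↓  : ∀ {e₁ e₂} → e₁ ↓ → e₂ ↓ → (e₁ · e₂) ↓
    *↓  : ∀ {e} → (e *) ↓

  data _─[_]→_ : StExp A → A → StExp A → Set where
    act→ : ∀ {a} → act a ─[ a ]→ 𝟙
    +→₁  : ∀ {e₁ e₂ a e′} → e₁ ─[ a ]→ e′ → (e₁ + e₂) ─[ a ]→ e′
    +→₂  : ∀ {e₁ e₂ a e′} → e₂ ─[ a ]→ e′ → (e₁ + e₂) ─[ a ]→ e′
    ·→₁  : ∀ {e₁ e₂ a e′} → e₁ ─[ a ]→ e′ → (e₁ · e₂) ─[ a ]→ (e′ · e₂)
    ·→₂  : ∀ {e₁ e₂ a e′} → e₁ ↓ → e₂ ─[ a ]→ e′ → (e₁ · e₂) ─[ a ]→ e′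
    *→   : ∀ {e a e′} → e ─[ a ]→ e′ → (e *) ─[ a ]→ (e′ · e *)

  -- Contains every expression reachable from e in at least one step.
  derivatives : StExp A → List (StExp A)
  derivatives 𝟘         = []
  derivatives 𝟙         = []
  derivatives (act _)   = [ 𝟙 ]
  derivatives (e₁ + e₂) = derivatives e₁ ++ derivatives e₂
  derivatives (e₁ · e₂) = map (_· e₂) (derivatives e₁) ++ derivatives e₂
  derivatives (e *)     = map (_· e *) (derivatives e)

  step-derivatives : ∀ {e a e′} → e ─[ a ]→ e′ → e′ ∈ derivatives e
  step-derivatives act→ = here refl
  step-derivatives (+→₁ t) = ∈-++⁺ˡ (step-derivatives t)
  step-derivatives {e₁ + e₂} (+→₂ t) =
    ∈-++⁺ʳ (derivatives e₁) (step-derivatives t)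
  step-derivatives {e₁ · e₂} (·→₁ t) =
    ∈-++⁺ˡ (∈-map⁺ (_· e₂) (step-derivatives t))
  step-derivatives {e₁ · e₂} (·→₂ _ t) =
    ∈-++⁺ʳ (map (_· e₂) (derivatives e₁)) (step-derivatives t)
  step-derivatives {e *} (*→ t) = ∈-map⁺ (_· e *) (step-derivatives t)

  derivatives-closed : ∀ e {x a y} → x ∈ derivatives e → x ─[ a ]→ y →
                       y ∈ derivatives e
  derivatives-closed (act _) (here refl) ()
  derivatives-closed (e₁ + e₂) m t with ∈-++⁻ (derivatives e₁) m
  ... | inj₁ m₁ = ∈-++⁺ˡ (derivatives-closed e₁ m₁ t)
  ... | inj₂ m₂ = ∈-++⁺ʳ (derivatives e₁) (derivatives-closed e₂ m₂ t)
  derivatives-closed (e₁ · e₂) m t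
    with ∈-++⁻ (map (_· e₂) (derivatives e₁)) m
  ... | inj₂ m₂ =
    ∈-++⁺ʳ (map (_· e₂) (derivatives e₁)) (derivatives-closed e₂ m₂ t)
  ... | inj₁ m₁ with ∈-map⁻ (_· e₂) m₁ | t
  ...   | _ , n , refl | ·→₁ u =
    ∈-++⁺ˡ (∈-map⁺ (_· e₂) (derivatives-closed e₁ n u))
  ...   | _ , n , refl | ·→₂ _ u =
    ∈-++⁺ʳ (map (_· e₂) (derivatives e₁)) (step-derivatives u)
  derivatives-closed (e *) m t with ∈-map⁻ (_· e *) m | t
  ... | _ , n , refl | ·→₁ u   = ∈-map⁺ (_· e *) (derivatives-closed e n u)
  ... | _ , n , refl | ·→₂ _ u = step-derivatives u

  reachable-finite : ∀ e → Finite (Reachable _─[_]→_ e)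
  reachable-finite e = e ∷ derivatives e , from-start
    where
    onwards : ∀ {x y} → x ∈ derivatives e → Reachable _─[_]→_ x y →
              y ∈ derivatives e
    onwards m ε             = m
    onwards m ((_ , t) ◅ r) = onwards (derivatives-closed e m t) r

    from-start : Reachable _─[_]→_ e ⊆ (_∈ (e ∷ derivatives e))
    from-start ε             = here refl
    from-start ((_ , t) ◅ r) = there (onwards (step-derivatives t) r)

  𝒞 : StExp A → Chart A (StExp A)
  𝒞 e = reachableChart _─[_]→_ _↓ e (reachable-finite e)

{-# OPTIONS --safe #-}
-- A set K of transitions, each reachable from the start vertex within K,
-- survives every elimination of loop subcharts when no transition x → y of K
-- can be a loop-entry transition: either y terminates and differs from x
-- (against L3), or an infinite path of K leaves from y and avoids x (against
-- L2). If K moreover contains an infinite path, LEE fails. Apart from the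
-- transitions that leave the start vertex, K is as follows. For (a* · b*)* it
-- is the two-cycle between the derivatives by a and b, both of which terminate.
-- For f₀* · 0 it is the complete graph, without self-loops, on the three
-- derivatives by a₁, a₂, a₃: a transition between two of them is followed by
-- the two-cycle that avoids its source.
module Submission where

open import Defs
open import Data.Bool.Base using (Bool; true; false)
open import Data.Fin.Base using (Fin; zero; suc)
open import Data.Fin.Properties using (_≟_; all?; any?)
open import Data.List.Base using (List; _∷_; []; lookup)
open import Data.List.Membership.Propositional.Properties using (∈-lookup)
open import Data.List.Relation.Unary.Unique.Propositional using (Unique; _∷_)
import Data.List.Relation.Unary.All as All
open import Data.Nat.Base using (ℕ; zero; suc; _<_)
open import Data.Product.Base using (∃; ∃-syntax; _×_; _,_; proj₂)
open import Data.Sum.Base using (_⊎_; inj₁; inj₂)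
open import Function.Base using (_∘_)
open import Function.Definitions using (Injective)
open import Level using (0ℓ)
open import Relation.Binary.Construct.Closure.ReflexiveTransitive using (ε; _◅_; map)
open import Relation.Binary.PropositionalEquality using (_≡_; _≢_; refl; sym; cong; ≢-sym)
open import Relation.Nullary using (¬_; contradiction)
open import Relation.Nullary.Decidable using (toWitness; ¬?; _×-dec_)
open import Relation.Unary using (Pred; _⊆_; U; ∅)

lookup-injective : {X : Set} {xs : List X} → Unique xs → Injective _≡_ _≡_ (lookup xs)
lookup-injective (_ ∷ _)   {zero}  {zero}  _  = refl
lookup-injective (x∉ ∷ _)  {zero}  {suc j} eq = contradiction eq (All.lookup x∉ (∈-lookup j))
lookup-injective (x∉ ∷ _)  {suc i} {zero}  eq = contradiction (sym eq) (All.lookup x∉ (∈-lookup i))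
lookup-injective (_ ∷ xs!) {suc _} {suc _} eq = cong suc (lookup-injective xs! eq)

third : (i j : Fin 3) → ∃[ k ] (k ≢ i × k ≢ j)
third = toWitness {a? = all? λ i → all? λ j → any? λ k → ¬? (k ≟ i) ×-dec ¬? (k ≟ j)} _

-- Infinite runs and reachability in a bare relation

module _ {A V : Set} where

  -- Based on a relation instead of a chart, so that one run serves for every chart containing that
  -- relation. `P` is used to express that a vertex is avoided.
  record Run (R : LabelledRel A V) (P : Pred V 0ℓ) (x : V) : Set where
    field
      vertex : ℕ → V
      label  : ℕ → A
      begins : vertex 0 ≡ x
      steps  : ∀ n → R (vertex n) (label n) (vertex (suc n))
      within : ∀ n → P (vertex n)

  Run-mono : {R S : LabelledRel A V} → (∀ {x a y} → R x a y → S x a y) →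
             {P : Pred V 0ℓ} → Run R P ⊆ Run S P
  Run-mono R⊆S run = record
    { vertex = vertex
    ; label  = label
    ; begins = begins
    ; steps  = λ n → R⊆S (steps n)
    ; within = within
    }
    where open Run run

  -- Swapping the arguments makes the tail of the sequence definitionally the sequence from the
  -- other point.
  alternate : {X : Set} → X → X → ℕ → X
  alternate x y zero    = x
  alternate x y (suc n) = alternate y x n

  two-cycle : ∀ {R : LabelledRel A V} {P : Pred V 0ℓ} {x y a b} →
              R x a y → R y b x → P x → P y → Run R P x
  two-cycle {R} {P} {x} {y} {a} {b} r s px py = record
    { vertex = alternate x y
    ; label  = alternate a b
    ; begins = refl
    ; steps  = steps r s
    ; within = within px py
    }
    where
    steps : ∀ {x y a b} → R x a y → R y b x →
            ∀ n → R (alternate x y n) (alternate a b n) (alternate y x n)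
    steps r s zero    = r
    steps r s (suc n) = steps s r n

    within : ∀ {x y} → P x → P y → ∀ n → P (alternate x y n)
    within px py zero    = px
    within px py (suc n) = within py px n

  reachable-mono : {R S : LabelledRel A V} → (∀ {x a y} → R x a y → S x a y) →
                   ∀ {x} → Reachable R x ⊆ Reachable S x
  reachable-mono R⊆S = map (λ (a , r) → a , R⊆S r)

  -- What L2 and L3 forbid for loop-entry transitions

  module _ {C : Chart A V} (E : EntrySet C) where
    open Chart C
    open EntrySet E renaming (U to Entry)

    generated-source : ∀ {x a y} → Generated C E x a y →
                       Reachable (Generated C E) v x
    generated-source (entry _) = ε
    generated-source (onward g _ _) =
      Chart.target-vertex (generatedSubchart C E) (generated-source g , g)

    entry-target-not-terminating :
      IsLoopChart (generatedSubchart C E) →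
      ∀ {a y} → Entry a y → y ≢ v → ¬ Term y
    entry-target-not-terminating loop u y≢v ty =
      IsLoopChart.L3 loop r y≢v (r , ty)
      where r = (_ , entry u) ◅ ε

    -- Prefixing the run with the entry transition gives an infinite path of the generated subchart
    -- that never returns to `v`, against L2.
    entry-target-no-run :
      IsLoopChart (generatedSubchart C E) →
      ∀ {a y} → Entry a y → ¬ Run Step (_≢ v) y
    entry-target-no-run loop {a} u record
      { vertex = vertex ; label = label ; begins = refl
      ; steps = steps ; within = within } = returns (IsLoopChart.L2 loop path)
      where
      vertex′ : ℕ → V
      vertex′ zero    = v
      vertex′ (suc n) = vertex n

      label′ : ℕ → A
      label′ zero    = a
      label′ (suc n) = label n

      generated : ∀ n → Generated C E (vertex′ n) (label′ n) (vertex n)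
      generated zero    = entry u
      -- The path may continue onward because the run avoids `v`.
      generated (suc n) = onward (generated n) (within n) (steps n)

      path : InfinitePath (generatedSubchart C E) v
      path = record
        { vertex = vertex′
        ; label  = label′
        ; begins = refl
        ; steps  = λ n → generated-source (generated n) , generated n
        }

      returns : ¬ (∃[ n ] (0 < n × vertex′ n ≡ v))
      -- Position 0 is ruled out by `0 < n`; every later position lies on the run.
      returns (suc n , _ , eq) = within n eq

  -- Transition sets that survive elimination

  record Resistant (K : LabelledRel A V) (T : Pred V 0ℓ) (s : V) : Set where
    field
      -- Reachability is required inside `K`, so it persists in any chart that keeps `K`.
      source-reachable : ∀ {x a y} → K x a y → Reachable K s x
      term-reachable   : T ⊆ Reachable K s
      obstructed       : ∀ {x a y} → K x a y → (T y × y ≢ x) ⊎ Run K (_≢ x) y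
      run              : ∃ (Run K U)

  record Contains (K : LabelledRel A V) (T : Pred V 0ℓ) (s : V)
                  (C : Chart A V) : Set where
    field
      start-≡ : Chart.start C ≡ s
      step    : ∀ {x a y} → K x a y → Chart.Step C x a y
      term    : T ⊆ Chart.Term C

  module _ {K : LabelledRel A V} {T : Pred V 0ℓ} {s : V}
           (resistant : Resistant K T s) where
    open Resistant resistant

    -- By `obstructed`, no transition of `K` is a loop-entry transition, so all of `K` remains and
    -- keeps its sources and the vertices in `T` reachable.
    ⟹-preserves : ∀ {C D} → C ⟹ D → Contains K T s C → Contains K T s D
    ⟹-preserves {C} (elim E loop) record { start-≡ = refl ; step = step ; term = term } =
      record
        { start-≡ = refl
        ; step    = λ k → reachable-mono remains (source-reachable k) , remains k
        ; term    = λ t → reachable-mono remains (term-reachable t) , term t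
        }
      where
      remains : ∀ {x a y} → K x a y → Remaining C E x a y
      remains k = step k , λ (x≡v , u) → not-entry x≡v u (obstructed k)
        where
        not-entry : ∀ {x a y} → x ≡ EntrySet.v E → EntrySet.U E a y →
                    ¬ ((T y × y ≢ x) ⊎ Run K (_≢ x) y)
        not-entry refl u (inj₁ (t , y≢v)) =
          entry-target-not-terminating E loop u y≢v (term t)
        not-entry refl u (inj₂ r) =
          entry-target-no-run E loop u (Run-mono step r)

    resistant⇒¬LEE : ∀ {C} → Contains K T s C → ¬ LEE C
    resistant⇒¬LEE c (_ , ε , no-path) = no-path (_ , record
      { vertex = vertex
      ; label  = label
      ; begins = begins
      ; steps  = λ n → Contains.step c (steps n)
      })
      where open Run (proj₂ run)
    resistant⇒¬LEE c (_ , e ◅ es , no-path) =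
      resistant⇒¬LEE (⟹-preserves e c) (_ , es , no-path)

module _ {A : Set} where

  resistant⇒¬LEE-𝒞 : ∀ {K : LabelledRel A (StExp A)} {T e} → Resistant K T e →
                      (∀ {x a y} → K x a y → x ─[ a ]→ y) → T ⊆ _↓ →
                      ¬ LEE (𝒞 e)
  resistant⇒¬LEE-𝒞 resistant K⊆→ T⊆↓ = resistant⇒¬LEE resistant record
    { start-≡ = refl
    ; step    = λ k → reachable-mono K⊆→ (source-reachable k) , K⊆→ k
    ; term    = λ t → reachable-mono K⊆→ (term-reachable t) , T⊆↓ t
    }
    where open Resistant resistant

  -- The expression (a* · b*)*

  module _ (a b : A) where

    private
      e e₁ e₂ : StExp A
      e  = (act a * · act b *) *
      e₁ = 𝟙 · act a * · act b * · e
      e₂ = 𝟙 · act b * · e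

    data TwoCycle : LabelledRel A (StExp A) where
      e→e₁  : TwoCycle e a e₁
      e₁→e₂ : TwoCycle e₁ b e₂
      e₂→e₁ : TwoCycle e₂ a e₁

    data OnTwoCycle : Pred (StExp A) 0ℓ where
      on₁ : OnTwoCycle e₁
      on₂ : OnTwoCycle e₂

    twoCycle-resistant : Resistant TwoCycle OnTwoCycle e
    twoCycle-resistant = record
      { source-reachable = λ where
          e→e₁  → ε
          e₁→e₂ → reach₁
          e₂→e₁ → reach₂
      ; term-reachable = λ where
          on₁ → reach₁
          on₂ → reach₂
      ; obstructed = λ where
          e→e₁  → inj₁ (on₁ , λ ())
          e₁→e₂ → inj₁ (on₂ , λ ())
          e₂→e₁ → inj₁ (on₁ , λ ())
      ; run = _ , two-cycle e₁→e₂ e₂→e₁ _ _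
      }
      where
      reach₁ : Reachable TwoCycle e e₁
      reach₁ = (_ , e→e₁) ◅ ε
      reach₂ : Reachable TwoCycle e e₂
      reach₂ = (_ , e→e₁) ◅ (_ , e₁→e₂) ◅ ε

    ¬LEE-[a*b*]* : ¬ LEE (𝒞 e)
    ¬LEE-[a*b*]* = resistant⇒¬LEE-𝒞 twoCycle-resistant
      (λ where
        e→e₁  → *→ (·→₁ (*→ act→))
        e₁→e₂ → ·→₁ (·→₂ (·↓ 𝟙↓ *↓) (*→ act→))
        e₂→e₁ → ·→₂ (·↓ 𝟙↓ *↓) (*→ (·→₁ (*→ act→))))
      (λ where
        on₁ → ·↓ (·↓ (·↓ 𝟙↓ *↓) *↓) *↓
        on₂ → ·↓ (·↓ 𝟙↓ *↓) *↓)

  -- The expression f₀* · 0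

  module _ (f : StExp A) (α : Fin 3 → A) (g : Fin 3 → StExp A)
           (g≢f : ∀ i → g i ≢ f) (g-injective : Injective _≡_ _≡_ g) where

    data Triangle : LabelledRel A (StExp A) where
      enter : ∀ i → Triangle f (α i) (g i)
      cross : ∀ {i j} → i ≢ j → Triangle (g i) (α j) (g j)

    triangle-run : ∀ {P i j} → i ≢ j → P (g i) → P (g j) → Run Triangle P (g i)
    triangle-run i≢j = two-cycle (cross i≢j) (cross (≢-sym i≢j))

    triangle-resistant : Resistant Triangle ∅ f
    triangle-resistant = record
      { source-reachable = λ where
          (enter _)     → ε
          (cross {i} _) → (_ , enter i) ◅ ε
      ; term-reachable = λ ()
      ; obstructed = λ where
          -- No transition of `Triangle` leads back to `f`, so the two-cycle through `g i` and any
          -- other `g k` avoids it.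
          (enter i) → let k , k≢i , _ = third i i in
            inj₂ (triangle-run (≢-sym k≢i) (g≢f i) (g≢f k))
          (cross {i} {j} i≢j) → let k , k≢i , k≢j = third i j in
            inj₂ (triangle-run (≢-sym k≢j) (≢-sym i≢j ∘ g-injective) (k≢i ∘ g-injective))
      ; run = _ , triangle-run {i = zero} {j = suc zero} (λ ()) _ _
      }

  module _ (a₁ a₂ a₃ b₁ b₂ b₃ : A) where

    private
      α β : Fin 3 → A
      α = lookup (a₁ ∷ a₂ ∷ a₃ ∷ [])
      β = lookup (b₁ ∷ b₂ ∷ b₃ ∷ [])

      f₀ f : StExp A
      f₀ = act a₁ · (𝟙 + act b₁ · 𝟘)
           + (act a₂ · (𝟙 + act b₂ · 𝟘) + act a₃ · (𝟙 + act b₃ · 𝟘))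
      f = f₀ * · 𝟘

      g : Fin 3 → StExp A
      g i = 𝟙 · (𝟙 + act (β i) · 𝟘) · f₀ * · 𝟘

      f₀→ : ∀ i → f₀ ─[ α i ]→ (𝟙 · (𝟙 + act (β i) · 𝟘))
      f₀→ zero             = +→₁ (·→₁ act→)
      f₀→ (suc zero)       = +→₂ (+→₁ (·→₁ act→))
      f₀→ (suc (suc zero)) = +→₂ (+→₂ (·→₁ act→))

    ¬LEE-f₀*0 : Unique (b₁ ∷ b₂ ∷ b₃ ∷ []) → ¬ LEE (𝒞 f)
    ¬LEE-f₀*0 unique = resistant⇒¬LEE-𝒞
      (triangle-resistant f α g (λ _ ()) g-injective)
      (λ where
        (enter i)         → ·→₁ (*→ (f₀→ i))
        -- The summand 1 lets the current iteration terminate, so `f₀ *` can start its next one with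
        -- any of the three actions.
        (cross {j = j} _) → ·→₁ (·→₂ (·↓ 𝟙↓ (+↓₁ 𝟙↓)) (*→ (f₀→ j))))
      (λ ())
      where
      -- With variables in place of `β i` and `β j`, matching on `refl` can unify the labels.
      label-injective : ∀ {b c : A} {e} →
        𝟙 · (𝟙 + act b · 𝟘) · e · 𝟘 ≡ 𝟙 · (𝟙 + act c · 𝟘) · e · 𝟘 → b ≡ c
      label-injective refl = refl

      g-injective : Injective _≡_ _≡_ g
      g-injective = lookup-injective unique ∘ label-injective

mainTheorem3 :
  (¬ ((A : Set) (e : StExp A) → LEE (𝒞 e)))
  × ((A : Set) (a b : A) → a ≢ b →
       ¬ LEE (𝒞 ((act a * · act b *) *)))
  × ((A : Set) (a₁ a₂ a₃ b₁ b₂ b₃ : A) →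
       Unique (a₁ ∷ a₂ ∷ a₃ ∷ b₁ ∷ b₂ ∷ b₃ ∷ []) →
       let f₀ = act a₁ · (𝟙 + act b₁ · 𝟘)
                + (act a₂ · (𝟙 + act b₂ · 𝟘) + act a₃ · (𝟙 + act b₃ · 𝟘))
       in ¬ LEE (𝒞 (f₀ * · 𝟘)))
mainTheorem3 =
    (λ lee → ¬LEE-[a*b*]* true false (lee Bool _))
  , (λ A a b _ → ¬LEE-[a*b*]* a b)
  , λ where
      A a₁ a₂ a₃ b₁ b₂ b₃ (_ ∷ _ ∷ _ ∷ unique) → ¬LEE-f₀*0 a₁ a₂ a₃ b₁ b₂ b₃ unique
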